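{- For every formula $A$ of $\mathbf{L_1}$, if $\vdash_T A$ then $\vdash_H A$.
   Context: Formulas of $\mathbf{L_1}$: built from atomic formulas $\epsilon ab$ ($a,b$ name variables, possibly equal) with primitive connectives $\vee,\sim$; $\wedge,\supset,\equiv$ defined as usual. $\vdash_H A$: $A$ belongs to the smallest set of formulas containing all instances of classical propositional tautologies and all formulas $\epsilon ab\supset\epsilon aa$, $(\epsilon ab\wedge\epsilon bc)\supset\epsilon ac$, $(\epsilon ab\wedge\epsilon bb)\supset\epsilon ba$, closed under modus ponens. Positive/negative parts (occurrences): $A$ is a positive part of $A$; if $B\vee C$ is a positive part then $B,C$ are positive parts; if $\sim B$ is a positive part then $B$ is a negative part; if $\sim B$ is a negative part then $B$ is a positive part. $F[B_+]$ ($G[B_-]$) denotes a formula with a specified occurrence of $B$ as positive (negative) part; $F[B_+,C_-]$ etc. denote specified non-overlapping occurrences. Tableaux: reduction rules ($\vee_-$) $G[B\vee C_-]$ $\mapsto$ two branches $G[B\vee C_-]\vee\sim B$, $G[B\vee C_-]\vee\sim C$; ($\epsilon_1$) $G[\epsilon ab_-]\mapsto G[\epsilon ab_-]\vee\sim\epsilon aa$; ($\epsilon_2$) $G[\epsilon ab_-,\epsilon bc_-]\mapsto G[\epsilon ab_-,\epsilon bc_-]\vee\sim\epsilon ac$; ($\epsilon_{3b}$) $G[\epsilon ab_-,\epsilon bb_-]\mapsto G[\epsilon ab_-,\epsilon bb_-]\vee\sim\epsilon ba$. A tableau for $A$ is a finite tree with root $A$ whose non-leaf nodes have as children the result of applying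 one rule. A branch is closed if its last formula has the form $F[B_+,B_-]$; a tableau is closed if all its branches are closed. $\vdash_T A$: $A$ has a closed tableau. -}

module Defs where

open import Data.Bool using (Bool; true; not) renaming (_∨_ to _or_)
open import Data.Nat using (ℕ)
open import Data.Product using (Σ; Σ-syntax; ∃-syntax; _×_; _,_)
open import Data.Sign using (Sign; +; -)
open import Relation.Binary.PropositionalEquality using (_≡_)
open import Relation.Nullary using (¬_)

infix  9 ∼_
infixr 7 _∧_
infixr 6 _∨_
infixr 5 _⊃_
infix  4 _⊑_ _⟶_ _⟶_∣_
infix  3 ⊢H_ ⊢T_

data Form (X : Set) : Set where
  atom : X → Form X
  _∨_  : Form X → Form X → Form X
  ∼_   : Form X → Form X

_∧_ _⊃_ : {X : Set} → Form X → Form X → Form X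
A ∧ B = ∼ (∼ A ∨ ∼ B)
A ⊃ B = ∼ A ∨ B

eval : {X : Set} → (X → Bool) → Form X → Bool
eval v (atom x) = v x
eval v (A ∨ B)  = eval v A or eval v B
eval v (∼ A)    = not (eval v A)

_[_] : {X Y : Set} → Form X → (X → Form Y) → Form Y
atom x  [ σ ] = σ x
(A ∨ B) [ σ ] = (A [ σ ]) ∨ (B [ σ ])
(∼ A)   [ σ ] = ∼ (A [ σ ])

-- Name variables, and separately the variables of propositional schemata,
-- are taken from a countably infinite supply.
Name : Set
Name = ℕ

PropForm : Set
PropForm = Form ℕ

Tautology : PropForm → Set
Tautology P = (v : ℕ → Bool) → eval v P ≡ true

Formula : Set
Formula = Form (Name × Name)

pattern ε a b = atom (a , b)

data ⊢H_ : Formula → Set where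
  taut : (P : PropForm) → Tautology P → (σ : ℕ → Formula) → ⊢H (P [ σ ])
  ax₁  : (a b : Name) → ⊢H (ε a b ⊃ ε a a)
  ax₂  : (a b c : Name) → ⊢H ((ε a b ∧ ε b c) ⊃ ε a c)
  ax₃  : (a b : Name) → ⊢H ((ε a b ∧ ε b b) ⊃ ε b a)
  mp   : {A B : Formula} → ⊢H A → ⊢H (A ⊃ B) → ⊢H B

-- An element of Part A s B is an occurrence of B in A as a part of sign s:
-- the derivation records the path from the root of A to that occurrence.
data Part (A : Formula) : Sign → Formula → Set where
  root : Part A + A
  ∨ˡ   : {B C : Formula} → Part A + (B ∨ C) → Part A + B
  ∨ʳ   : {B C : Formula} → Part A + (B ∨ C) → Part A + C
  ∼₊   : {B : Formula} → Part A + (∼ B) → Part A - B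
  ∼₋   : {B : Formula} → Part A - (∼ B) → Part A + B

-- p ⊑ q : the occurrence q lies inside (or is) the occurrence p.
data _⊑_ {A : Formula} {s : Sign} {D : Formula} (p : Part A s D) :
         {t : Sign} {E : Formula} → Part A t E → Set where
  ⊑-refl : p ⊑ p
  ⊑-∨ˡ   : {B C : Formula} {q : Part A + (B ∨ C)} → p ⊑ q → p ⊑ ∨ˡ q
  ⊑-∨ʳ   : {B C : Formula} {q : Part A + (B ∨ C)} → p ⊑ q → p ⊑ ∨ʳ q
  ⊑-∼₊   : {B : Formula} {q : Part A + (∼ B)} → p ⊑ q → p ⊑ ∼₊ q
  ⊑-∼₋   : {B : Formula} {q : Part A - (∼ B)} → p ⊑ q → p ⊑ ∼₋ q

NonOverlapping : {A : Formula} {s t : Sign} {D E : Formula} →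
                 Part A s D → Part A t E → Set
NonOverlapping p q = ¬ (p ⊑ q) × ¬ (q ⊑ p)

data _⟶_ (G : Formula) : Formula → Set where
  ε₁  : {a b : Name} → Part G - (ε a b) → G ⟶ G ∨ ∼ ε a a
  ε₂  : {a b c : Name} (p : Part G - (ε a b)) (q : Part G - (ε b c)) →
        NonOverlapping p q → G ⟶ G ∨ ∼ ε a c
  ε₃b : {a b : Name} (p : Part G - (ε a b)) (q : Part G - (ε b b)) →
        NonOverlapping p q → G ⟶ G ∨ ∼ ε b a

data _⟶_∣_ (G : Formula) : Formula → Formula → Set where
  ∨₋ : {B C : Formula} → Part G - (B ∨ C) → G ⟶ G ∨ ∼ B ∣ G ∨ ∼ C

data Tableau (G : Formula) : Set where
  leaf   : Tableau G
  unary  : {H : Formula} → G ⟶ H → Tableau H → Tableau G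
  binary : {H K : Formula} → G ⟶ H ∣ K → Tableau H → Tableau K → Tableau G

data Branch {G : Formula} : Tableau G → Set where
  end   : Branch leaf
  down  : {H : Formula} {r : G ⟶ H} {T : Tableau H} →
          Branch T → Branch (unary r T)
  left  : {H K : Formula} {r : G ⟶ H ∣ K} {T : Tableau H} {U : Tableau K} →
          Branch T → Branch (binary r T U)
  right : {H K : Formula} {r : G ⟶ H ∣ K} {T : Tableau H} {U : Tableau K} →
          Branch U → Branch (binary r T U)

lastFormula : {G : Formula} {T : Tableau G} → Branch T → Formula
lastFormula {G} end   = G
lastFormula (down b)  = lastFormula b
lastFormula (left b)  = lastFormula b
lastFormula (right b) = lastFormula b

-- F has the form F[B₊, B₋] for some formula B.
HasClosingPair : Formula → Set
HasClosingPair F =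
  ∃[ B ] Σ[ p ∈ Part F + B ] Σ[ q ∈ Part F - B ] NonOverlapping p q

ClosedBranch : {G : Formula} {T : Tableau G} → Branch T → Set
ClosedBranch b = HasClosingPair (lastFormula b)

ClosedTableau : {G : Formula} → Tableau G → Set
ClosedTableau T = (b : Branch T) → ClosedBranch b

⊢T_ : Formula → Set
⊢T A = Σ (Tableau A) ClosedTableau

{-# OPTIONS --safe #-}

-- A positive part B of A satisfies ⊢H B ⊃ A, and a negative part B satisfies
-- ⊢H ∼ B ⊃ A.  Hence a formula with a closing pair is provable, and each
-- reduction rule, read upwards, preserves provability: the disjunct it adds is
-- the negation of something implied by the negative parts it acts on.

module Submission where

open import Defs
open import Data.Bool using (Bool; true; false) renaming (_∧_ to _and_)
open import Data.Nat using (ℕ; zero; suc)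
open import Data.Product using (_,_)
open import Data.Sign using (+; -)
open import Relation.Binary.PropositionalEquality using (_≡_; refl)

private
  variable
    A B C F G : Formula

-- Turns a truth table into a closed computation, so that `refl` can certify it.
everywhere : (Bool → Bool) → Bool
everywhere f = f true and f false

everywhere-sound : (f : Bool → Bool) → everywhere f ≡ true → ∀ x → f x ≡ true
everywhere-sound f h x with f true in t | f false in u
everywhere-sound f h true  | true | true = t
everywhere-sound f h false | true | true = u

-- Polymorphic so as to serve both as a valuation and as the substitution that instantiates a
-- schema.
triple : {X : Set} → X → X → X → ℕ → X
triple x y z zero          = x
triple x y z (suc zero)    = y
triple x y z (suc (suc _)) = z

valid₃ : PropForm → Bool
valid₃ P = everywhere λ x → everywhere λ y → everywhere λ z →
           eval (triple x y z) P

valid₃-sound : (P : PropForm) → valid₃ P ≡ true →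
               ∀ x y z → eval (triple x y z) P ≡ true
valid₃-sound P h x y z =
  everywhere-sound (λ z → eval (triple x y z) P)
    (everywhere-sound (λ y → everywhere λ z → eval (triple x y z) P)
      (everywhere-sound
        (λ x → everywhere λ y → everywhere λ z → eval (triple x y z) P) h x) y) z

private
  p q r : PropForm
  p = atom 0
  q = atom 1
  r = atom 2

⊃-refl : ⊢H (A ⊃ A)
-- Since `P` is concrete, evaluating it under `v` or under a `triple` of values of `v` reduces to
-- the same term. Positions whose atom is absent from `P` are filled arbitrarily.
⊃-refl {A} = taut P (λ v → valid₃-sound P refl (v 0) (v 0) (v 0)) (triple A A A)
  where P = p ⊃ p

∨-⊃ˡ : ⊢H (B ∨ C ⊃ A) → ⊢H (B ⊃ A)
∨-⊃ˡ {B} {C} {A} h =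
  mp h (taut P (λ v → valid₃-sound P refl (v 0) (v 1) (v 2)) (triple B C A))
  where P = (p ∨ q ⊃ r) ⊃ (p ⊃ r)

∨-⊃ʳ : ⊢H (B ∨ C ⊃ A) → ⊢H (C ⊃ A)
∨-⊃ʳ {B} {C} {A} h =
  mp h (taut P (λ v → valid₃-sound P refl (v 0) (v 1) (v 2)) (triple B C A))
  where P = (p ∨ q ⊃ r) ⊃ (q ⊃ r)

∼∼-⊃ : ⊢H (∼ ∼ B ⊃ A) → ⊢H (B ⊃ A)
∼∼-⊃ {B} {A} h =
  mp h (taut P (λ v → valid₃-sound P refl (v 0) (v 1) (v 1)) (triple B A A))
  where P = (∼ ∼ p ⊃ q) ⊃ (p ⊃ q)

excluded-middle : ⊢H (B ⊃ A) → ⊢H (∼ B ⊃ A) → ⊢H A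
excluded-middle {B} {A} h k =
  mp k (mp h (taut P (λ v → valid₃-sound P refl (v 0) (v 1) (v 1)) (triple B A A)))
  where P = (p ⊃ q) ⊃ ((∼ p ⊃ q) ⊃ q)

∼∧-⊃ : ⊢H (∼ B ⊃ A) → ⊢H (∼ C ⊃ A) → ⊢H (∼ (B ∧ C) ⊃ A)
∼∧-⊃ {B} {A} {C} h k =
  mp k (mp h (taut P (λ v → valid₃-sound P refl (v 0) (v 1) (v 2)) (triple B A C)))
  where P = (∼ p ⊃ q) ⊃ ((∼ r ⊃ q) ⊃ (∼ (p ∧ r) ⊃ q))

-- If `A` failed, the first premise would give `B ∨ C` and the other two would refute both
-- disjuncts.
∨-elim : ⊢H (∼ (B ∨ C) ⊃ A) → ⊢H (A ∨ ∼ B) → ⊢H (A ∨ ∼ C) → ⊢H A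
∨-elim {B} {C} {A} h k l =
  mp l (mp k (mp h
    (taut P (λ v → valid₃-sound P refl (v 0) (v 1) (v 2)) (triple B C A))))
  where P = (∼ (p ∨ q) ⊃ r) ⊃ ((r ∨ ∼ p) ⊃ ((r ∨ ∼ q) ⊃ r))

-- The first two premises yield `A ∨ C`, and the third removes `C`, the formula whose negation a
-- rule adds.
cut : ⊢H (∼ B ⊃ A) → ⊢H (B ⊃ C) → ⊢H (A ∨ ∼ C) → ⊢H A
cut {B} {A} {C} h k l =
  mp l (mp k (mp h
    (taut P (λ v → valid₃-sound P refl (v 0) (v 1) (v 2)) (triple B A C))))
  where P = (∼ p ⊃ q) ⊃ ((p ⊃ r) ⊃ ((q ∨ ∼ r) ⊃ q))

mutual
  positive-part : Part A + B → ⊢H (B ⊃ A)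
  positive-part root   = ⊃-refl
  positive-part (∨ˡ o) = ∨-⊃ˡ (positive-part o)
  positive-part (∨ʳ o) = ∨-⊃ʳ (positive-part o)
  positive-part (∼₋ o) = ∼∼-⊃ (negative-part o)

  -- A negative `B` arises only from a positive `∼ B`, where the claim is already that of
  -- `positive-part`.
  negative-part : Part A - B → ⊢H (∼ B ⊃ A)
  negative-part (∼₊ o) = positive-part o

closing-pair-provable : HasClosingPair F → ⊢H F
closing-pair-provable (_ , o , o′ , _) =
  excluded-middle (positive-part o) (negative-part o′)

⟶-reflects-⊢H : G ⟶ F → ⊢H F → ⊢H G
⟶-reflects-⊢H (ε₁ {a} {b} o)          = cut (negative-part o) (ax₁ a b)
⟶-reflects-⊢H (ε₂ {a} {b} {c} o o′ _) =
  -- The two negative parts merge into the conjunction that is the antecedent of the axiom.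
  cut (∼∧-⊃ (negative-part o) (negative-part o′)) (ax₂ a b c)
⟶-reflects-⊢H (ε₃b {a} {b} o o′ _)    =
  cut (∼∧-⊃ (negative-part o) (negative-part o′)) (ax₃ a b)

⟶∣-reflects-⊢H : G ⟶ A ∣ B → ⊢H A → ⊢H B → ⊢H G
⟶∣-reflects-⊢H (∨₋ o) = ∨-elim (negative-part o)

-- Each branch of a subtableau extends to one of the whole with the same last formula, so closedness
-- passes down.
closed-tableau-provable : (T : Tableau G) → ClosedTableau T → ⊢H G
closed-tableau-provable leaf c = closing-pair-provable (c end)
closed-tableau-provable (unary s T) c =
  ⟶-reflects-⊢H s (closed-tableau-provable T λ b → c (down b))
closed-tableau-provable (binary s T U) c =
  ⟶∣-reflects-⊢H s (closed-tableau-provable T λ b → c (left b))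
                   (closed-tableau-provable U λ b → c (right b))

theorem2p2 : (A : Formula) → ⊢T A → ⊢H A
theorem2p2 A (T , c) = closed-tableau-provable T c
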